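{- For each cardinal $\kappa$ with $\kappa\notin\{2,4\}$ and $\kappa\leq 2^{\aleph_0}$, there exists a semirigid system of three equivalence relations on a set of cardinality $\kappa$.
   Context: A map $f:E\to E$ preserves an equivalence relation $\rho$ on $E$ if $(x,y)\in\rho$ implies $(f(x),f(y))\in\rho$. A system of equivalence relations on $E$ is semirigid if the only self-maps $f:E\to E$ preserving every relation of the system are the identity map and the constant maps. -}

module Defs where

open import Data.Product using (∃)
open import Data.Sum using (_⊎_)
open import Function.Base using (id)
open import Level using (0ℓ)
open import Relation.Binary.Core using (Rel; _Preserves_⟶_)
open import Relation.Binary.PropositionalEquality using (_≡_; _≗_)
open import Relation.Binary.Structures using (IsEquivalence)

record EquivalenceRelation (E : Set) : Set₁ where
  field
    rel           : Rel E 0ℓ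
    isEquivalence : IsEquivalence rel

open EquivalenceRelation public

-- A system is an indexed family; repeated members are allowed.
System : Set → Set → Set₁
System I E = I → EquivalenceRelation E

PreservesSystem : {I E : Set} → (E → E) → System I E → Set
PreservesSystem f ρ = ∀ i → f Preserves rel (ρ i) ⟶ rel (ρ i)

IsConstant : {E : Set} → (E → E) → Set
IsConstant f = ∃ λ c → ∀ x → f x ≡ c

-- The converse (the identity and the constant maps preserve every system)
-- holds automatically, the latter by reflexivity.
Semirigid : {I E : Set} → System I E → Set
Semirigid {E = E} ρ =
  (f : E → E) → PreservesSystem f ρ → (f ≗ id) ⊎ IsConstant f

{-# OPTIONS --safe #-}

-- Finite sets. On a path 0, …, 2m take the kernels of ⌊i/2⌋, ⌈i/2⌉ and the parity of i. Any two
-- of them meet trivially and consecutive triples are triangles, so a preserving map that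
-- identifies two neighbours is constant, and any other one walks along the path without turning
-- back; as it has no room to move it is the identity. An even number n ≥ 6 of points is obtained
-- by adding a point tied to both ends of the path.
--
-- Infinite sets. Excluded middle for all small types provides choice, and exhausting K by
-- injective sequences along a well-ordered tower gives K ≈ J × ℕ up to a finite remainder. Each
-- j ∈ J is a binary word, which is written along a ray attached to a six-point core, the triangle
-- of side 2, in such a way that all triangles (three points pairwise related by the three
-- relations) lie in the core. A preserving map f either collapses the middle triangle of the core,
-- and then the core to a point o; as every ray is then mapped into triangles around o, which have
-- no room in the core, f is constant. Or f fixes the core, and maps the ray of j along the ray of
-- some i, reading the word of j as a tail of the word of i; the words are chosen so that this
-- forces equality.
module Submission where

open import Defs
open import Axiom.ExcludedMiddle using (ExcludedMiddle)
open import Axiom.Extensionality.Propositional using (Extensionality)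
open import Axiom.UniquenessOfIdentityProofs.WithK using (uip)
open import Data.Bool using (Bool; true; false; _∨_)
open import Data.Bool.Properties using (∨-zeroʳ; ¬-not)
open import Data.Fin using (Fin; zero; suc; toℕ; fromℕ<)
open import Data.Fin.Properties using (toℕ-injective; toℕ-fromℕ<; toℕ<n) renaming (_≟_ to _≟ᶠ_)
open import Data.List using (List; []; _∷_; length; lookup; deduplicate)
open import Data.List.Membership.Propositional using (_∈_; _∉_)
open import Data.List.Membership.Propositional.Properties using (∈-lookup; ∈-deduplicate⁺)
import Data.List.Relation.Unary.All as All
open import Data.List.Relation.Unary.AllPairs using (_∷_)
open import Data.List.Relation.Unary.Any using (here; there; index)
open import Data.List.Relation.Unary.Any.Properties using (lookup-index)
open import Data.List.Relation.Unary.Unique.DecPropositional.Properties using (deduplicate-!)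
open import Data.List.Relation.Unary.Unique.Propositional using (Unique)
open import Data.Maybe using (Maybe; just; nothing)
open import Data.Maybe.Properties using (just-injective)
open import Data.Nat using (ℕ; zero; suc; _+_; _≤_; _<_; z≤n; s≤s; s≤s⁻¹; ⌊_/2⌋; ⌈_/2⌉; _≤?_;
  _≤′_; ≤′-refl; ≤′-step)
open import Data.Nat.Properties
  using (suc-injective; +-suc; +-identityʳ; +-cancelˡ-≡; +-mono-≤; m≤m+n; m≤n+m; m+n≮m; n≤1+n; ≤-refl; ≤-trans;
         ≤-antisym; <⇒≤; <-cmp; ≤⇒≤′; m<n⇒n≢0; m⊓n≤n; m≤n⇒m⊓n≡m; ⌊n/2⌋+⌈n/2⌉≡n; n≡⌊n+n/2⌋; n≡⌈n+n/2⌉)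
open import Data.Product using (Σ-syntax; _×_; _,_; proj₁; proj₂)
open import Data.Sum using (_⊎_; inj₁; inj₂)
open import Data.Unit using (⊤; tt)
open import Function.Base using (id; _∘_)
open import Function.Bundles using (_↣_; _⤖_; mk⤖; Injection)
open import Function.Consequences.Propositional using (strictlySurjective⇒surjective)
open import Function.Construct.Symmetry using (⤖-sym)
open import Function.Definitions using (Injective)
open import Level using (0ℓ)
import Relation.Binary.Construct.On as On
open import Relation.Binary.Definitions using (DecidableEquality; tri<; tri≈; tri>)
open import Relation.Binary.PropositionalEquality
  using (_≡_; _≢_; _≗_; refl; sym; trans; cong; cong₂; subst)
import Relation.Binary.PropositionalEquality as ≡
open import Relation.Nullary using (¬_; Dec; yes; no; does; contradiction)
open import Relation.Nullary.Decidable
  using (map′; _×-dec_; _→-dec_; ¬?; from-yes; decidable-stable; dec-true)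

-- Finite sets

kernel : {E L : Set} → (E → L) → EquivalenceRelation E
kernel ℓ = record
  { rel           = λ x y → ℓ x ≡ ℓ y
  ; isEquivalence = On.isEquivalence ℓ ≡.isEquivalence
  }

kernels : {E L₀ L₁ L₂ : Set} → (E → L₀) → (E → L₁) → (E → L₂) → System (Fin 3) E
kernels ℓ₀ ℓ₁ ℓ₂ zero             = kernel ℓ₀
kernels ℓ₀ ℓ₁ ℓ₂ (suc zero)       = kernel ℓ₁
kernels ℓ₀ ℓ₁ ℓ₂ (suc (suc zero)) = kernel ℓ₂

even : ℕ → Bool
even zero          = true
even (suc zero)    = false
even (suc (suc n)) = even n

even-double : ∀ n → even (n + n) ≡ true
even-double zero    = refl
even-double (suc n) rewrite +-suc n n = even-double n

half-neighbours : ∀ s t → ⌊ s /2⌋ ≡ ⌊ t /2⌋ → s ≢ t →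
  (even s ≡ true × t ≡ suc s) ⊎ (even s ≡ false × s ≡ suc t)
half-neighbours zero zero _ s≢t = contradiction refl s≢t
half-neighbours zero (suc zero) _ _ = inj₁ (refl , refl)
half-neighbours (suc zero) zero _ _ = inj₂ (refl , refl)
half-neighbours (suc zero) (suc zero) _ s≢t = contradiction refl s≢t
half-neighbours (suc (suc s)) (suc (suc t)) e s≢t
  with half-neighbours s t (suc-injective e) (s≢t ∘ cong (2 +_))
... | inj₁ (ev , refl) = inj₁ (ev , refl)
... | inj₂ (od , refl) = inj₂ (od , refl)

half-even-injective : ∀ s t → ⌊ s /2⌋ ≡ ⌊ t /2⌋ → even s ≡ even t → s ≡ t
half-even-injective zero          zero          _ _ = refl
half-even-injective zero          (suc zero)    _ ()
half-even-injective (suc zero)    zero          _ ()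
half-even-injective (suc zero)    (suc zero)    _ _ = refl
half-even-injective (suc (suc s)) (suc (suc t)) e e′ =
  cong (2 +_) (half-even-injective s t (suc-injective e) e′)

even-suc : ∀ s t → even s ≡ even t → even (suc s) ≡ even (suc t)
even-suc zero          zero          _ = refl
even-suc zero          (suc (suc t)) e = even-suc zero t e
even-suc (suc zero)    (suc zero)    _ = refl
even-suc (suc zero)    (suc (suc t)) e = even-suc 1 t e
even-suc (suc (suc s)) t             e = even-suc s t e

ceil-even-injective : ∀ s t → ⌈ s /2⌉ ≡ ⌈ t /2⌉ → even s ≡ even t → s ≡ t
ceil-even-injective s t e e′ = suc-injective (half-even-injective (suc s) (suc t) e (even-suc s t e′))

halves-injective : ∀ s t → ⌊ s /2⌋ ≡ ⌊ t /2⌋ → ⌈ s /2⌉ ≡ ⌈ t /2⌉ → s ≡ t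
halves-injective s t e e′ = trans (sym (⌊n/2⌋+⌈n/2⌉≡n s)) (trans (cong₂ _+_ e e′) (⌊n/2⌋+⌈n/2⌉≡n t))

-- Serves both finite cases: `E` may contain points off the path `p 0, …, p N`, so the labels are
-- prescribed on the path only, and `nothing` is left free in `ℓ₂` for other points.
module Strip
  (N : ℕ) (N-even : even N ≡ true) (E : Set) (p : ℕ → E)
  (ℓ₀ ℓ₁ : E → ℕ) (ℓ₂ : E → Maybe Bool)
  (ℓ₀-p : ∀ {i} → i ≤ N → ℓ₀ (p i) ≡ ⌊ i /2⌋)
  (ℓ₁-p : ∀ {i} → i ≤ N → ℓ₁ (p i) ≡ ⌈ i /2⌉)
  (ℓ₂-p : ∀ {i} → i ≤ N → ℓ₂ (p i) ≡ just (even i))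
  (meet₀₂ : ∀ u v → ℓ₀ u ≡ ℓ₀ v → ℓ₂ u ≡ ℓ₂ v → u ≡ v)
  (meet₁₂ : ∀ u v → ℓ₁ u ≡ ℓ₁ v → ℓ₂ u ≡ ℓ₂ v → u ≡ v)
  (f : E → E) (pres : PreservesSystem f (kernels ℓ₀ ℓ₁ ℓ₂))
  where

  -- colour i is the label shared by the i-th and the (i+1)-st point of the path.
  colour : ℕ → E → ℕ
  colour zero          = ℓ₀
  colour (suc zero)    = ℓ₁
  colour (suc (suc i)) = colour i

  -- For fixed i, the label of p j under colour i differs from ⌊ i + j /2⌋ by a constant.
  colour-p⁺ : ∀ i {j k} → j ≤ N → k ≤ N → ⌊ i + j /2⌋ ≡ ⌊ i + k /2⌋ → colour i (p j) ≡ colour i (p k)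
  colour-p⁺ zero          j≤ k≤ e = trans (ℓ₀-p j≤) (trans e (sym (ℓ₀-p k≤)))
  colour-p⁺ (suc zero)    j≤ k≤ e = trans (ℓ₁-p j≤) (trans e (sym (ℓ₁-p k≤)))
  colour-p⁺ (suc (suc i)) j≤ k≤ e = colour-p⁺ i j≤ k≤ (suc-injective e)

  colour-p⁻ : ∀ i {j k} → j ≤ N → k ≤ N → colour i (p j) ≡ colour i (p k) → ⌊ i + j /2⌋ ≡ ⌊ i + k /2⌋
  colour-p⁻ zero          j≤ k≤ e = trans (sym (ℓ₀-p j≤)) (trans e (ℓ₀-p k≤))
  colour-p⁻ (suc zero)    j≤ k≤ e = trans (sym (ℓ₁-p j≤)) (trans e (ℓ₁-p k≤))
  colour-p⁻ (suc (suc i)) j≤ k≤ e = cong suc (colour-p⁻ i j≤ k≤ e)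

  colour-pres : ∀ i {u v} → colour i u ≡ colour i v → colour i (f u) ≡ colour i (f v)
  colour-pres zero          {u} {v} = pres zero {u} {v}
  colour-pres (suc zero)    {u} {v} = pres (suc zero) {u} {v}
  colour-pres (suc (suc i))         = colour-pres i

  colour-meet : ∀ i {u v} → colour i u ≡ colour i v → ℓ₂ u ≡ ℓ₂ v → u ≡ v
  colour-meet zero          = meet₀₂ _ _
  colour-meet (suc zero)    = meet₁₂ _ _
  colour-meet (suc (suc i)) = colour-meet i

  g : ℕ → E
  g i = f (p i)

  g-colour : ∀ i → suc i ≤ N → colour i (g i) ≡ colour i (g (suc i))
  g-colour i i<N = colour-pres i (colour-p⁺ i (<⇒≤ i<N) i<N (begin
    ⌊ i + i /2⌋     ≡⟨ sym (n≡⌊n+n/2⌋ i) ⟩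
    i               ≡⟨ n≡⌈n+n/2⌉ i ⟩
    ⌈ i + i /2⌉     ≡⟨ cong ⌊_/2⌋ (sym (+-suc i i)) ⟩
    ⌊ i + suc i /2⌋ ∎))
    where open ≡.≡-Reasoning

  g-ℓ₂ : ∀ i → 2 + i ≤ N → ℓ₂ (g i) ≡ ℓ₂ (g (2 + i))
  g-ℓ₂ i 2+i≤N = pres (suc (suc zero)) {p i} {p (2 + i)}
    (trans (ℓ₂-p (≤-trans (m≤n+m i 2) 2+i≤N)) (sym (ℓ₂-p 2+i≤N)))

  -- The images of a triangle form a triangle: `g (1 + i)` and `g (2 + i)` share colour `suc i`, and
  -- once `g i` equals `g (1 + i)` they share `ℓ₂` too.
  collapse-forward : ∀ i → 2 + i ≤ N → g i ≡ g (1 + i) → g (1 + i) ≡ g (2 + i)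
  collapse-forward i 2+i≤N e = colour-meet (suc i) (g-colour (suc i) 2+i≤N)
    (trans (cong ℓ₂ (sym e)) (g-ℓ₂ i 2+i≤N))

  collapse-backward : ∀ i → 2 + i ≤ N → g (1 + i) ≡ g (2 + i) → g i ≡ g (1 + i)
  collapse-backward i 2+i≤N e = colour-meet i (g-colour i (<⇒≤ 2+i≤N))
    (trans (g-ℓ₂ i 2+i≤N) (cong ℓ₂ (sym e)))

  collapsed : g 0 ≡ g 1 → ∀ i → suc i ≤ N → g i ≡ g (suc i)
  collapsed e zero    _     = e
  collapsed e (suc i) 2+i≤N = collapse-forward i 2+i≤N (collapsed e i (<⇒≤ 2+i≤N))

  constant : g 0 ≡ g 1 → ∀ i → i ≤ N → g i ≡ g 0
  constant e zero    _   = refl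
  constant e (suc i) i<N = trans (sym (collapsed e i i<N)) (constant e i (<⇒≤ i<N))

  module _ (g₀≢g₁ : g 0 ≢ g 1) where

    nowhere-collapsed : ∀ i → suc i ≤ N → g i ≢ g (suc i)
    nowhere-collapsed zero    _     e = g₀≢g₁ e
    nowhere-collapsed (suc i) 2+i≤N e =
      nowhere-collapsed i (<⇒≤ 2+i≤N) (collapse-backward i 2+i≤N e)

    module _ (on-path : ∀ i → i ≤ N → Σ[ k ∈ ℕ ] k ≤ N × g i ≡ p k) where

      -- The edge of colour `i` at `p k` leads up when `i + k` is even and down when it is odd. As
      -- `i` grows by 1, `i + k` changes by 2 or by 0, so the direction persists.
      next : ∀ i k → suc i ≤ N → k ≤ N → g i ≡ p k → Σ[ k′ ∈ ℕ ] k′ ≤ N × g (suc i) ≡ p k′ ×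
        ((even (i + k) ≡ true × i + k′ ≡ suc (i + k)) ⊎ (even (i + k) ≡ false × i + k ≡ suc (i + k′)))
      next i k i<N k≤N e with k′ , k′≤N , e′ ← on-path (suc i) i<N =
        k′ , k′≤N , e′ , half-neighbours (i + k) (i + k′)
          (colour-p⁻ i k≤N k′≤N (trans (cong (colour i) (sym e)) (trans (g-colour i i<N) (cong (colour i) e′))))
          λ eq → nowhere-collapsed i i<N (trans e (trans (cong p (+-cancelˡ-≡ i k k′ eq)) (sym e′)))

      increasing : ∀ k₀ → k₀ ≤ N → g 0 ≡ p k₀ → even k₀ ≡ true →
        ∀ i → i ≤ N → i + k₀ ≤ N × even (i + (i + k₀)) ≡ true × g i ≡ p (i + k₀)
      increasing k₀ k₀≤N e ev zero    _   = k₀≤N , ev , e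
      increasing k₀ k₀≤N e ev (suc i) i<N
        with k≤N , ev′ , e′ ← increasing k₀ k₀≤N e ev i (<⇒≤ i<N)
        with next i (i + k₀) i<N k≤N e′
      ... | _  , _     , _  , inj₂ (od , _) = contradiction (trans (sym ev′) od) λ ()
      ... | k′ , k′≤N , e″ , inj₁ (_ , eq)
        with refl ← +-cancelˡ-≡ i k′ (suc (i + k₀)) (trans eq (sym (+-suc i (i + k₀)))) =
        k′≤N , trans (cong even (cong suc (+-suc i (i + k₀)))) ev′ , e″

      decreasing : ∀ k₀ → k₀ ≤ N → g 0 ≡ p k₀ → even k₀ ≡ false →
        ∀ i → i ≤ N → Σ[ k ∈ ℕ ] k ≤ N × g i ≡ p k × i + k ≡ k₀
      decreasing k₀ k₀≤N e od zero    _   = k₀ , k₀≤N , e , refl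
      decreasing k₀ k₀≤N e od (suc i) i<N
        with k , k≤N , e′ , refl ← decreasing k₀ k₀≤N e od i (<⇒≤ i<N)
        with next i k i<N k≤N e′
      ... | _  , _    , _  , inj₁ (ev , _) = contradiction (trans (sym ev) od) λ ()
      ... | k′ , k′≤N , e″ , inj₂ (_ , eq) = k′ , k′≤N , e″ , sym eq

      -- Look at the far end. A rising walk has reached `N + k₀`, which forces `k₀ = 0`. A falling
      -- one has descended `N` steps from `k₀ ≤ N`, so `k₀ = N`; but `N` is even, while falling
      -- walks start at odd `k₀`.
      identity : ∀ i → i ≤ N → g i ≡ p i
      identity i i≤N with k₀ , k₀≤N , e ← on-path 0 z≤n with even k₀ in par
      ... | true with refl ← +-cancelˡ-≡ N k₀ 0 (trans
          (≤-antisym (proj₁ (increasing k₀ k₀≤N e par N ≤-refl)) (m≤m+n N k₀))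
          (sym (+-identityʳ N))) =
        trans (proj₂ (proj₂ (increasing 0 z≤n e refl i i≤N))) (cong p (+-identityʳ i))
      ... | false with k , _ , _ , refl ← decreasing k₀ k₀≤N e par N ≤-refl =
        contradiction (trans (sym N-even) (trans (cong even (≤-antisym (m≤m+n N k) k₀≤N)) par)) λ ()

module Path (m : ℕ) where

  N : ℕ
  N = m + m

  -- Truncated at `N` to be total on ℕ, as `Strip` expects.
  p : ℕ → Fin (suc N)
  p i = fromℕ< (s≤s (m⊓n≤n i N))

  toℕ-p : ∀ {i} → i ≤ N → toℕ (p i) ≡ i
  toℕ-p i≤N = trans (toℕ-fromℕ< _) (m≤n⇒m⊓n≡m i≤N)

  p-toℕ : ∀ u → u ≡ p (toℕ u)
  p-toℕ u = toℕ-injective (sym (toℕ-p (s≤s⁻¹ (toℕ<n u))))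

  ℓ₀ ℓ₁ : Fin (suc N) → ℕ
  ℓ₀ u = ⌊ toℕ u /2⌋
  ℓ₁ u = ⌈ toℕ u /2⌉
  ℓ₂ : Fin (suc N) → Maybe Bool
  ℓ₂ u = just (even (toℕ u))

  meet₀₁ : ∀ u v → ℓ₀ u ≡ ℓ₀ v → ℓ₁ u ≡ ℓ₁ v → u ≡ v
  meet₀₁ u v e e′ = toℕ-injective (halves-injective _ _ e e′)

  meet₀₂ : ∀ u v → ℓ₀ u ≡ ℓ₀ v → ℓ₂ u ≡ ℓ₂ v → u ≡ v
  meet₀₂ u v e e′ = toℕ-injective (half-even-injective _ _ e (just-injective e′))

  meet₁₂ : ∀ u v → ℓ₁ u ≡ ℓ₁ v → ℓ₂ u ≡ ℓ₂ v → u ≡ v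
  meet₁₂ u v e e′ = toℕ-injective (ceil-even-injective _ _ e (just-injective e′))

  system : System (Fin 3) (Fin (suc N))
  system = kernels ℓ₀ ℓ₁ ℓ₂

  semirigid : Semirigid system
  semirigid f pres = conclude (S.g 0 ≟ᶠ S.g 1)
    where
    module S = Strip N (even-double m) (Fin (suc N)) p ℓ₀ ℓ₁ ℓ₂
      (cong ⌊_/2⌋ ∘ toℕ-p) (cong ⌈_/2⌉ ∘ toℕ-p) (cong (just ∘ even) ∘ toℕ-p)
      meet₀₂ meet₁₂ f pres
    conclude : Dec (S.g 0 ≡ S.g 1) → (f ≗ id) ⊎ IsConstant f
    conclude (yes eq) = inj₂ (_ , λ u → trans (cong f (p-toℕ u)) (S.constant eq _ (s≤s⁻¹ (toℕ<n u))))
    conclude (no neq) = inj₁ λ u → trans (cong f (p-toℕ u)) (trans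
      (S.identity neq (λ i _ → toℕ (S.g i) , s≤s⁻¹ (toℕ<n _) , p-toℕ _) _ (s≤s⁻¹ (toℕ<n u)))
      (sym (p-toℕ u)))

-- The extra point zero shares ℓ₀ with the end and ℓ₁ with the start of the path, which
-- breaks the symmetry i ↦ n - 1 - i of a path with an even number n of points.
module PointedPath (m : ℕ) (1<m : 1 < m) where

  module P = Path m
  open P using (N; toℕ-p; p-toℕ)

  E : Set
  E = Fin (suc (suc N))

  p : ℕ → E
  p i = suc (P.p i)

  ℓ₀ ℓ₁ : E → ℕ
  ℓ₀ zero    = m
  ℓ₀ (suc u) = P.ℓ₀ u
  ℓ₁ zero    = 0
  ℓ₁ (suc u) = P.ℓ₁ u
  ℓ₂ : E → Maybe Bool
  ℓ₂ zero    = nothing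
  ℓ₂ (suc u) = P.ℓ₂ u

  -- Only the start of the path has `ℓ₁` equal to 0, and its `ℓ₀` is 0 rather than `m`; thus the
  -- extra point meets no path point in both labels.
  m≢half : ∀ n → 0 ≡ ⌈ n /2⌉ → m ≢ ⌊ n /2⌋
  m≢half zero _ = m<n⇒n≢0 1<m

  meet₀₁ : ∀ u v → ℓ₀ u ≡ ℓ₀ v → ℓ₁ u ≡ ℓ₁ v → u ≡ v
  meet₀₁ zero    zero    _ _  = refl
  meet₀₁ zero    (suc v) e e′ = contradiction e (m≢half (toℕ v) e′)
  meet₀₁ (suc u) zero    e e′ = contradiction (sym e) (m≢half (toℕ u) (sym e′))
  meet₀₁ (suc u) (suc v) e e′ = cong suc (P.meet₀₁ u v e e′)

  meet₀₂ : ∀ u v → ℓ₀ u ≡ ℓ₀ v → ℓ₂ u ≡ ℓ₂ v → u ≡ v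
  meet₀₂ zero    zero    _ _  = refl
  meet₀₂ (suc u) (suc v) e e′ = cong suc (P.meet₀₂ u v e e′)

  meet₁₂ : ∀ u v → ℓ₁ u ≡ ℓ₁ v → ℓ₂ u ≡ ℓ₂ v → u ≡ v
  meet₁₂ zero    zero    _ _  = refl
  meet₁₂ (suc u) (suc v) e e′ = cong suc (P.meet₁₂ u v e e′)

  ℓ₂-zero : ∀ {u} → ℓ₂ u ≡ nothing → u ≡ zero
  ℓ₂-zero {zero} _ = refl

  system : System (Fin 3) E
  system = kernels ℓ₀ ℓ₁ ℓ₂

  semirigid : Semirigid system
  semirigid f pres = conclude (S.g 0 ≟ᶠ S.g 1)
    where
    module S = Strip N (even-double m) E p ℓ₀ ℓ₁ ℓ₂
      (cong ⌊_/2⌋ ∘ toℕ-p) (cong ⌈_/2⌉ ∘ toℕ-p) (cong (just ∘ even) ∘ toℕ-p)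
      meet₀₂ meet₁₂ f pres
    open S using (g)

    f-zero₀ : ℓ₀ (f zero) ≡ ℓ₀ (g N)
    f-zero₀ = pres zero {zero} {p N} (trans (n≡⌊n+n/2⌋ m) (cong ⌊_/2⌋ (sym (toℕ-p ≤-refl))))

    f-zero₁ : ℓ₁ (f zero) ≡ ℓ₁ (g 0)
    f-zero₁ = pres (suc zero) {zero} {p 0} refl

    -- After a return, `g i` and `g (1 + i)` would share both colours `i` and `suc i`, hence
    -- coincide.
    no-return : ∀ i → 2 + i ≤ N → g 0 ≢ g 1 → g i ≢ g (2 + i)
    no-return i 2+i≤N g₀≢g₁ e =
      S.nowhere-collapsed g₀≢g₁ i (<⇒≤ 2+i≤N) (both i (S.g-colour i (<⇒≤ 2+i≤N))
        (trans (cong (S.colour (suc i)) e) (sym (S.g-colour (suc i) 2+i≤N))))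
      where
      both : ∀ i {u v} → S.colour i u ≡ S.colour i v → S.colour (suc i) u ≡ S.colour (suc i) v → u ≡ v
      both zero          e e′ = meet₀₁ _ _ e e′
      both (suc zero)    e e′ = meet₀₁ _ _ e′ e
      both (suc (suc i)) e e′ = both i e e′

    -- The extra point is alone in its class of `ℓ₂`, so a visit at `i` is repeated two steps later
    -- or earlier, which is a return. One of these two indices lies on the path because `N ≥ 4`.
    misses-zero : g 0 ≢ g 1 → ∀ i → i ≤ N → g i ≢ zero
    misses-zero g₀≢g₁ i i≤N e with 2 + i ≤? N
    ... | yes 2+i≤N = no-return i 2+i≤N g₀≢g₁
      (trans e (sym (ℓ₂-zero (trans (sym (S.g-ℓ₂ i 2+i≤N)) (cong ℓ₂ e)))))
    misses-zero g₀≢g₁ (suc (suc i)) i≤N e | no _ = no-return i i≤N g₀≢g₁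
      (trans (ℓ₂-zero (trans (S.g-ℓ₂ i i≤N) (cong ℓ₂ e))) (sym e))
    misses-zero g₀≢g₁ 0 i≤N e | no 2≰N = 2≰N (≤-trans 1<m (m≤m+n m m))
    misses-zero g₀≢g₁ 1 i≤N e | no 3≰N = 3≰N (≤-trans (n≤1+n 3) (+-mono-≤ 1<m 1<m))

    on-path : g 0 ≢ g 1 → ∀ i → i ≤ N → Σ[ k ∈ ℕ ] k ≤ N × g i ≡ p k
    on-path g₀≢g₁ i i≤N with g i in eq
    ... | zero  = contradiction eq (misses-zero g₀≢g₁ i i≤N)
    ... | suc u = toℕ u , s≤s⁻¹ (toℕ<n u) , cong suc (p-toℕ u)

    conclude : Dec (g 0 ≡ g 1) → (f ≗ id) ⊎ IsConstant f
    conclude (yes eq) = inj₂ (g 0 , λ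
      { zero    → meet₀₁ _ _ (trans f-zero₀ (cong ℓ₀ (S.constant eq N ≤-refl))) f-zero₁
      ; (suc u) → trans (cong (f ∘ suc) (p-toℕ u)) (S.constant eq _ (s≤s⁻¹ (toℕ<n u))) })
    conclude (no neq) = inj₁ λ
      { zero    → meet₀₁ _ _
          (trans f-zero₀ (trans (cong ℓ₀ (fixes N ≤-refl)) (trans (cong ⌊_/2⌋ (toℕ-p ≤-refl)) (sym (n≡⌊n+n/2⌋ m)))))
          (trans f-zero₁ (cong ℓ₁ (fixes 0 z≤n)))
      ; (suc u) → trans (cong (f ∘ suc) (p-toℕ u)) (trans (fixes _ (s≤s⁻¹ (toℕ<n u))) (cong suc (sym (p-toℕ u)))) }
      where
      fixes : ∀ i → i ≤ N → g i ≡ p i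
      fixes = S.identity neq (on-path neq)

odd⊎even : ∀ n → n ≡ 0 ⊎ (Σ[ m ∈ ℕ ] n ≡ suc (m + m)) ⊎ (Σ[ m ∈ ℕ ] n ≡ suc (suc (m + m)))
odd⊎even zero = inj₁ refl
odd⊎even (suc n) with odd⊎even n
... | inj₁ refl              = inj₂ (inj₁ (0 , refl))
... | inj₂ (inj₁ (m , refl)) = inj₂ (inj₂ (m , refl))
... | inj₂ (inj₂ (m , refl)) = inj₂ (inj₁ (suc m , cong (2 +_) (sym (+-suc m m))))

finite : ∀ n → n ≢ 2 → n ≢ 4 → Σ[ ρ ∈ System (Fin 3) (Fin n) ] Semirigid ρ
finite n n≢2 n≢4 with odd⊎even n
... | inj₁ refl = kernels id id id , λ _ _ → inj₁ λ ()
... | inj₂ (inj₁ (m , refl)) = Path.system m , Path.semirigid m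
... | inj₂ (inj₂ (0 , refl)) = contradiction refl n≢2
... | inj₂ (inj₂ (1 , refl)) = contradiction refl n≢4
... | inj₂ (inj₂ (suc (suc m) , refl)) = PointedPath.system (suc (suc m)) 1<m , PointedPath.semirigid (suc (suc m)) 1<m
  where
  1<m : 1 < suc (suc m)
  1<m = s≤s (s≤s z≤n)

-- Decomposition of infinite sets

lookup-injective : {A : Set} {l : List A} → Unique l → Injective _≡_ _≡_ (lookup l)
lookup-injective (_  ∷ _) {zero}  {zero}  _  = refl
lookup-injective (∉l ∷ _) {zero}  {suc j} eq = contradiction eq (All.lookup ∉l (∈-lookup j))
lookup-injective (∉l ∷ _) {suc i} {zero}  eq = contradiction (sym eq) (All.lookup ∉l (∈-lookup i))
lookup-injective (_  ∷ u) {suc i} {suc j} eq = cong suc (lookup-injective u eq)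

listed⇒finite : {K : Set} → DecidableEquality K → (l : List K) → (∀ k → k ∈ l) → Σ[ n ∈ ℕ ] Fin n ⤖ K
listed⇒finite _≟_ l all∈ = length l! , mk⤖
  ( lookup-injective (deduplicate-! _≟_ l)
  , strictlySurjective⇒surjective λ k → index (k∈ k) , sym (lookup-index (k∈ k)))
  where
  l! = deduplicate _≟_ l
  k∈ : ∀ k → k ∈ l!
  k∈ k = ∈-deduplicate⁺ _≟_ (all∈ k)

-- The Cantor-Bernstein theorem

module CantorBernstein
  (em : ExcludedMiddle 0ℓ) {A B : Set}
  (f : A → B) (f-injective : Injective _≡_ _≡_ f)
  (g : B → A) (g-injective : Injective _≡_ _≡_ g)
  where

  -- The points whose backward history under `g` and `f` ends in `A`, outside the image of `g`. The
  -- bijection is `f` on them and inverts `g` elsewhere.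
  data Chain : A → Set where
    start : ∀ {a} → (∀ b → g b ≢ a) → Chain a
    next  : ∀ {a} → Chain a → Chain (g (f a))

  preimage : ∀ {a} → ¬ Chain a → Σ[ b ∈ B ] g b ≡ a
  preimage ¬chain = decidable-stable em λ none → ¬chain (start λ b eq → none (b , eq))

  predecessor : ∀ {a b} → Chain a → a ≡ g b → Σ[ a′ ∈ A ] Chain a′ × f a′ ≡ b
  predecessor (start none) eq = contradiction (sym eq) (none _)
  predecessor (next chain) eq = _ , chain , g-injective eq

  h′ : ∀ a → Dec (Chain a) → B
  h′ a (yes _)     = f a
  h′ a (no ¬chain) = proj₁ (preimage ¬chain)

  f≢preimage : ∀ {a a′} (¬chain : ¬ Chain a′) → Chain a → f a ≢ proj₁ (preimage ¬chain)
  f≢preimage ¬chain chain eq =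
    ¬chain (subst Chain (trans (cong g eq) (proj₂ (preimage ¬chain))) (next chain))

  h′-injective : ∀ {a a′} d d′ → h′ a d ≡ h′ a′ d′ → a ≡ a′
  h′-injective (yes _)  (yes _)  eq = f-injective eq
  h′-injective (yes c)  (no ¬c′) eq = contradiction eq (f≢preimage ¬c′ c)
  h′-injective (no ¬c)  (yes c′) eq = contradiction (sym eq) (f≢preimage ¬c c′)
  h′-injective (no ¬c)  (no ¬c′) eq =
    trans (sym (proj₂ (preimage ¬c))) (trans (cong g eq) (proj₂ (preimage ¬c′)))

  h′-yes : ∀ {a} d → Chain a → h′ a d ≡ f a
  h′-yes (yes _) _     = refl
  h′-yes (no ¬c) chain = contradiction chain ¬c

  h′-no : ∀ {a} d → ¬ Chain a → g (h′ a d) ≡ a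
  h′-no (yes c) ¬chain = contradiction c ¬chain
  h′-no (no ¬c) _      = proj₂ (preimage ¬c)

  h : A → B
  h a = h′ a em

  h-surjective : ∀ b → Σ[ a ∈ A ] h a ≡ b
  h-surjective b with em {Chain (g b)}
  ... | yes chain with a′ , chain′ , eq ← predecessor chain refl = a′ , trans (h′-yes em chain′) eq
  ... | no ¬chain = g b , g-injective (h′-no em ¬chain)

  bijection : A ⤖ B
  bijection = mk⤖ (h′-injective em em , strictlySurjective⇒surjective h-surjective)

-- Finite listing or injective sequence

module Sequences (em : ExcludedMiddle 0ℓ) {K : Set} (Q : K → Set) where

  InjectiveSequence : Set
  InjectiveSequence = Σ[ s ∈ (ℕ → K) ] Injective _≡_ _≡_ s × (∀ n → Q (s n))

  Listed : Set
  Listed = Σ[ l ∈ List K ] (∀ k → Q k → k ∈ l)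

  module _ (fresh : ∀ l → Σ[ k ∈ K ] Q k × k ∉ l) where

    prefix : ℕ → List K
    s : ℕ → K
    prefix zero    = []
    prefix (suc n) = s n ∷ prefix n
    s n = proj₁ (fresh (prefix n))

    earlier : ∀ {m n} → suc m ≤′ n → s m ∈ prefix n
    earlier ≤′-refl      = here refl
    earlier (≤′-step lt) = there (earlier lt)

    s-later : ∀ {m n} → m < n → s m ≢ s n
    s-later {n = n} m<n eq =
      proj₂ (proj₂ (fresh (prefix n))) (subst (_∈ prefix n) eq (earlier (≤⇒≤′ m<n)))

    s-injective : Injective _≡_ _≡_ s
    s-injective {m} {n} eq with <-cmp m n
    ... | tri< m<n _ _ = contradiction eq (s-later m<n)
    ... | tri≈ _ m≡n _ = m≡n
    ... | tri> _ _ n<m = contradiction (sym eq) (s-later n<m)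

    sequence : InjectiveSequence
    sequence = s , s-injective , λ n → proj₁ (proj₂ (fresh (prefix n)))

  -- Double negation elimination at Σ-types acts as a choice function: if no list exhausts `Q`, it
  -- picks a fresh point for every list.
  sequence⊎listed : InjectiveSequence ⊎ Listed
  sequence⊎listed with em {Listed}
  ... | yes listed = inj₂ listed
  ... | no ¬listed = inj₁ (sequence λ l → decidable-stable em λ none →
    ¬listed (l , λ k Qk → decidable-stable em λ k∉l → none (k , Qk , k∉l)))

-- Exhaustion of a set by disjoint injective sequences

module Tower (em : ExcludedMiddle 0ℓ) (ext : Extensionality 0ℓ 0ℓ) (K : Set) where

  ⟦_⟧ : Set → Bool
  ⟦ A ⟧ = does (em {A})

  ⟦⟧-intro : ∀ {A} → A → ⟦ A ⟧ ≡ true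
  ⟦⟧-intro = dec-true em

  ⟦⟧-elim : ∀ {A} → ⟦ A ⟧ ≡ true → A
  ⟦⟧-elim {A} _ with yes x ← em {A} = x

  Subset : Set
  Subset = K → Bool

  _∋_ : Subset → K → Set
  X ∋ k = X k ≡ true

  _⊆_ : Subset → Subset → Set
  X ⊆ Y = ∀ k → X ∋ k → Y ∋ k

  ⊆-antisym : ∀ {X Y} → X ⊆ Y → Y ⊆ X → X ≡ Y
  ⊆-antisym {X} {Y} X⊆Y Y⊆X = ext λ k → agree (X k) (Y k) (X⊆Y k) (Y⊆X k)
    where
    agree : ∀ s t → (s ≡ true → t ≡ true) → (t ≡ true → s ≡ true) → s ≡ t
    agree true  t     to from = sym (to refl)
    agree false true  to from = from refl
    agree false false to from = refl

  module Avoiding (X : Subset) = Sequences em (λ k → X k ≡ false)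

  -- As a Boolean equation it has at most one proof by `uip`, so the sequence chosen by `seq`
  -- depends on `X` alone.
  Coinfinite : Subset → Set
  Coinfinite X = ⟦ Avoiding.InjectiveSequence X ⟧ ≡ true

  seq : ∀ X → Coinfinite X → ℕ → K
  seq X co = proj₁ (⟦⟧-elim co)

  seq-injective : ∀ X co → Injective _≡_ _≡_ (seq X co)
  seq-injective X co = proj₁ (proj₂ (⟦⟧-elim co))

  seq-avoids : ∀ (X : Subset) co n → X (seq X co n) ≡ false
  seq-avoids X co = proj₂ (proj₂ (⟦⟧-elim co))

  NextTerm : Subset → K → Set
  NextTerm X k = Σ[ co ∈ Coinfinite X ] Σ[ n ∈ ℕ ] seq X co n ≡ k

  extend : Subset → Subset
  extend X k = X k ∨ ⟦ NextTerm X k ⟧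

  ⊆-extend : ∀ X → X ⊆ extend X
  ⊆-extend X k X∋k rewrite X∋k = refl

  extend-∋ : ∀ X co n → extend X ∋ seq X co n
  extend-∋ X co n = trans (cong (X (seq X co n) ∨_) (⟦⟧-intro (co , n , refl))) (∨-zeroʳ _)

  extend-elim : ∀ X k → extend X ∋ k → X ∋ k ⊎ NextTerm X k
  extend-elim X k e with X k
  ... | true  = inj₁ refl
  ... | false = inj₂ (⟦⟧-elim e)

  ⋃ : (Subset → Bool) → Subset
  ⋃ S k = ⟦ Σ[ X ∈ Subset ] S X ≡ true × X ∋ k ⟧

  -- Quantifying over all Boolean subsets keeps the tower small, so that ⟦_⟧ applies to it.
  data Stage : Subset → Set where
    next : ∀ {X} → Stage X → Stage (extend X)
    sup  : ∀ S → (∀ X → S X ≡ true → Stage X) → Stage (⋃ S)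

  -- Comparability of stages as in the Bourbaki-Witt theorem. A union is settled by asking whether
  -- all its members lie in `Y`. For a successor with `X ⊆ Y`, comparing `Y` with `X` in turn leaves
  -- `extend X ⊆ Y` or `X = Y`.
  compare : ∀ {X Y} → Stage X → Stage Y → X ⊆ Y ⊎ extend Y ⊆ X
  compare {Y = Y} (sup S stages) σ with em {Σ[ X ∈ Subset ] S X ≡ true × ¬ (X ⊆ Y)}
  ... | no none = inj₁ λ k k∈ → case-⋃ k (⟦⟧-elim k∈)
    where
    case-⋃ : ∀ k → Σ[ X ∈ Subset ] S X ≡ true × X ∋ k → Y ∋ k
    case-⋃ k (X , SX , X∋k) = decidable-stable em (λ X⊈Y → none (X , SX , X⊈Y)) k X∋k
  ... | yes (X , SX , X⊈Y) with compare (stages X SX) σ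
  ...   | inj₁ X⊆Y  = contradiction X⊆Y X⊈Y
  ...   | inj₂ eY⊆X = inj₂ λ k k∈ → ⟦⟧-intro (X , SX , eY⊆X k k∈)
  compare (next {X} ξ) υ with compare ξ υ
  ... | inj₂ eY⊆X = inj₂ λ k k∈ → ⊆-extend X k (eY⊆X k k∈)
  ... | inj₁ X⊆Y with compare υ ξ
  ...   | inj₂ eX⊆Y = inj₁ eX⊆Y
  ...   | inj₁ Y⊆X with refl ← ⊆-antisym X⊆Y Y⊆X = inj₂ λ _ → id

  -- The Boolean flag makes an index determined by its subset, which `point-injective` needs.
  J : Set
  J = Σ[ X ∈ Subset ] ⟦ Stage X × Coinfinite X ⟧ ≡ true

  coinfinite : (j : J) → Coinfinite (proj₁ j)
  coinfinite (_ , e) = proj₂ (⟦⟧-elim e)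

  point : J → ℕ → K
  point j = seq (proj₁ j) (coinfinite j)

  -- The terms for `i` lie in `extend (proj₁ i)`, hence in the subset of `j`, which the sequence of
  -- `j` avoids.
  point-disjoint : ∀ {i j : J} {m n} → extend (proj₁ i) ⊆ proj₁ j → point i m ≢ point j n
  point-disjoint {i} {j} {m} {n} ei⊆j eq = contradiction
    (trans (sym (ei⊆j _ (extend-∋ (proj₁ i) (coinfinite i) m)))
           (trans (cong (proj₁ j) eq) (seq-avoids (proj₁ j) (coinfinite j) n)))
    λ ()

  point-injective : ∀ {i j m n} → point i m ≡ point j n → i ≡ j × m ≡ n
  point-injective {i@(X , e)} {j@(Y , e′)} eq
    with compare (proj₁ (⟦⟧-elim e)) (proj₁ (⟦⟧-elim e′))
  ... | inj₂ eY⊆X = contradiction (sym eq) (point-disjoint {j} {i} eY⊆X)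
  ... | inj₁ X⊆Y with compare (proj₁ (⟦⟧-elim e′)) (proj₁ (⟦⟧-elim e))
  ...   | inj₂ eX⊆Y = contradiction eq (point-disjoint {i} {j} eX⊆Y)
  ...   | inj₁ Y⊆X with refl ← ⊆-antisym X⊆Y Y⊆X with refl ← uip e e′ =
    refl , seq-injective X (coinfinite i) eq

  -- A point enters the tower only at a successor step, as a term of the sequence chosen there.
  covered : ∀ {X} → Stage X → ∀ k → X ∋ k → Σ[ j ∈ J ] Σ[ n ∈ ℕ ] point j n ≡ k
  covered (sup S stages) k k∈ with X , SX , X∋k ← ⟦⟧-elim k∈ = covered (stages X SX) k X∋k
  covered (next {X} ξ) k k∈ with extend-elim X k k∈
  ... | inj₁ X∋k = covered ξ k X∋k
  ... | inj₂ (co , n , eq) = (X , flag) , n , trans (cong (λ co → seq X co n) (uip _ co)) eq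
    where flag = ⟦⟧-intro (ξ , co)

  top : Subset
  top = ⋃ (λ X → ⟦ Stage X ⟧)

  top-stage : Stage top
  top-stage = sup _ λ X → ⟦⟧-elim

  -- `extend top` is again a stage and so contained in `top`; a sequence avoiding `top` would add a
  -- point to it.
  top-cofinite : ¬ Avoiding.InjectiveSequence top
  top-cofinite s = contradiction (trans (sym (top-closed _ (extend-∋ top co 0))) (seq-avoids top co 0)) λ ()
    where
    co : Coinfinite top
    co = ⟦⟧-intro s
    top-closed : extend top ⊆ top
    top-closed k k∈ = ⟦⟧-intro (extend top , ⟦⟧-intro (next top-stage) , k∈)

  remainder : Avoiding.Listed top
  remainder with Avoiding.sequence⊎listed top
  ... | inj₁ s      = contradiction s top-cofinite
  ... | inj₂ listed = listed

  Located : K → Set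
  Located k = (Σ[ j ∈ J ] Σ[ n ∈ ℕ ] point j n ≡ k) ⊎
              (Σ[ i ∈ Fin (length (proj₁ remainder)) ] lookup (proj₁ remainder) i ≡ k)

  locate : ∀ k → Located k
  locate k with top k in eq
  ... | true  = inj₁ (covered top-stage k eq)
  ... | false = inj₂ (index k∈ , sym (lookup-index k∈))
    where k∈ = proj₂ remainder k eq

  -- The empty stage, obtained as the union of no stages. It provides the index `j₀` whose sequence
  -- houses the core.
  first : (s : ℕ → K) → Injective _≡_ _≡_ s → J
  first s s-injective = ⋃ (λ _ → false) ,
    ⟦⟧-intro (sup _ (λ _ ()) , ⟦⟧-intro (s , s-injective , λ n → ¬-not λ k∈ → empty (⟦⟧-elim k∈)))
    where
    empty : ∀ {k} → ¬ (Σ[ X ∈ Subset ] false ≡ true × X ∋ k)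
    empty (_ , () , _)

-- The system on the core and the rays

-- The word 0 b₀ 0 b₁ ..., whose zeros prevent two consecutive ones.
spread : (ℕ → Bool) → ℕ → Bool
spread b zero          = false
spread b (suc zero)    = b 0
spread b (suc (suc n)) = spread (b ∘ suc) n

marked : (ℕ → Bool) → ℕ → Bool
marked b zero          = true
marked b (suc zero)    = true
marked b (suc (suc n)) = spread b n

spread-injective : ∀ b c → spread b ≗ spread c → b ≗ c
spread-injective b c eq zero    = eq 1
spread-injective b c eq (suc n) =
  spread-injective (b ∘ suc) (c ∘ suc) (λ m → eq (2 + m)) n

spread-isolated : ∀ b n → spread b n ≡ true → spread b (suc n) ≢ true
spread-isolated b (suc zero)    _  ()
spread-isolated b (suc (suc n)) eq = spread-isolated (b ∘ suc) n eq

-- The initial 11 occurs nowhere else, so no marked word is a proper tail of another.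
marked-tail : ∀ b c m → (∀ k → marked c (m + k) ≡ marked b k) → m ≡ 0 × c ≗ b
marked-tail b c zero eq = refl , spread-injective c b (λ n → eq (2 + n))
marked-tail b c (suc zero)  eq with () ← eq 1
marked-tail b c (suc (suc m)) eq = contradiction
  (subst (λ n → spread c n ≡ true) (trans (+-suc m 0) (cong suc (+-identityʳ m))) (eq 1))
  (spread-isolated c m (subst (λ n → spread c n ≡ true) (+-identityʳ m) (eq 0)))

-- The points with natural barycentric coordinates of sum 2; a′ is the midpoint opposite to a.
data Core : Set where
  a b c a′ b′ c′ : Core

data Coord : Set where
  #0 #1 #2 : Coord

x y z : Core → Coord
x a = #2
x b = #0
x c = #0
x a′ = #0
x b′ = #1
x c′ = #1
y a = #0
y b = #2
y c = #0
y a′ = #1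
y b′ = #0
y c′ = #1
z a = #0
z b = #0
z c = #2
z a′ = #1
z b′ = #1
z c′ = #0

_≟ᶜ_ : DecidableEquality Coord
#0 ≟ᶜ #0 = yes refl
#0 ≟ᶜ #1 = no λ ()
#0 ≟ᶜ #2 = no λ ()
#1 ≟ᶜ #0 = no λ ()
#1 ≟ᶜ #1 = yes refl
#1 ≟ᶜ #2 = no λ ()
#2 ≟ᶜ #0 = no λ ()
#2 ≟ᶜ #1 = no λ ()
#2 ≟ᶜ #2 = yes refl

coords-injective : ∀ p q → x p ≡ x q → y p ≡ y q → p ≡ q
coords-injective a a _ _ = refl
coords-injective b b _ _ = refl
coords-injective c c _ _ = refl
coords-injective a′ a′ _ _ = refl
coords-injective b′ b′ _ _ = refl
coords-injective c′ c′ _ _ = refl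

_≟_ : DecidableEquality Core
p ≟ q = map′ (λ (e , e′) → coords-injective p q e e′) (λ { refl → refl , refl })
             ((x p ≟ᶜ x q) ×-dec (y p ≟ᶜ y q))

all? : {P : Core → Set} → (∀ p → Dec (P p)) → Dec (∀ p → P p)
all? P? = map′
  (λ { (pa , pb , pc , pa′ , pb′ , pc′) →
       λ { a → pa ; b → pb ; c → pc ; a′ → pa′ ; b′ → pb′ ; c′ → pc′ } })
  (λ P → P a , P b , P c , P a′ , P b′ , P c′)
  (P? a ×-dec P? b ×-dec P? c ×-dec P? a′ ×-dec P? b′ ×-dec P? c′)

Triangleᶜ : Core → Core → Core → Set
Triangleᶜ p q r = x q ≡ x r × y p ≡ y r × z p ≡ z q

triangleᶜ? : ∀ p q r → Dec (Triangleᶜ p q r)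
triangleᶜ? p q r = (x q ≟ᶜ x r) ×-dec (y p ≟ᶜ y r) ×-dec (z p ≟ᶜ z q)

-- Abstract, because with-abstraction would otherwise unfold the whole enumeration.
abstract
  core-rigidᶜ : ∀ p q r → Triangleᶜ p q r → p ≢ q →
    ∀ s → y s ≡ y q → z s ≡ z r → ∀ t → x t ≡ x p → z t ≡ z r × z t ≡ z s →
    ∀ u → x u ≡ x p × x u ≡ x t → y u ≡ y q × y u ≡ y s →
    (s ≡ a × t ≡ b × u ≡ c) × (p ≡ a′ × q ≡ b′ × r ≡ c′)
  core-rigidᶜ = from-yes (all? λ p → all? λ q → all? λ r → triangleᶜ? p q r →-dec
    ((¬? (p ≟ q)) →-dec (all? λ s → (y s ≟ᶜ y q) →-dec ((z s ≟ᶜ z r) →-dec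
    (all? λ t → (x t ≟ᶜ x p) →-dec (((z t ≟ᶜ z r) ×-dec (z t ≟ᶜ z s)) →-dec
    (all? λ u → ((x u ≟ᶜ x p) ×-dec (x u ≟ᶜ x t)) →-dec (((y u ≟ᶜ y q) ×-dec (y u ≟ᶜ y s)) →-dec
    (((s ≟ a) ×-dec (t ≟ b) ×-dec (u ≟ c)) ×-dec ((p ≟ a′) ×-dec (q ≟ b′) ×-dec (r ≟ c′)))))))))))

-- The four triangles are consecutive sectors around o; no point of the core is interior,
-- hence none has room for them.
abstract
  no-windingᶜ : ∀ o g₀ → g₀ ≢ o → ∀ g₁ → Triangleᶜ o g₁ g₀ → ∀ g₂ → Triangleᶜ g₁ o g₂ →
    ∀ g₃ → Triangleᶜ g₃ g₂ o → ∀ g₄ → ¬ Triangleᶜ o g₄ g₃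
  no-windingᶜ = from-yes (all? λ o → all? λ g₀ → ¬? (g₀ ≟ o) →-dec
    (all? λ g₁ → triangleᶜ? o g₁ g₀ →-dec (all? λ g₂ → triangleᶜ? g₁ o g₂ →-dec
    (all? λ g₃ → triangleᶜ? g₃ g₂ o →-dec (all? λ g₄ → ¬? (triangleᶜ? o g₄ g₃))))))

abstract
  yz-injective : ∀ p q → y p ≡ y q → z p ≡ z q → p ≡ q
  yz-injective = from-yes (all? λ p → all? λ q → (y p ≟ᶜ y q) →-dec ((z p ≟ᶜ z q) →-dec (p ≟ q)))

abstract
  xz-injective : ∀ p q → x p ≡ x q → z p ≡ z q → p ≡ q
  xz-injective = from-yes (all? λ p → all? λ q → (x p ≟ᶜ x q) →-dec ((z p ≟ᶜ z q) →-dec (p ≟ q)))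

data Line (J : Set) : Set where
  grid : Coord → Line J
  link : J → ℕ → Line J

grid-injective : ∀ {J s t} → grid {J} s ≡ grid t → s ≡ t
grid-injective refl = refl

-- The line `x = 0` is avoided because it meets `y = 2` at `b` and `z = 2` at `c`.
letter : Bool → Coord
letter true  = #1
letter false = #2

letter≢#0 : ∀ t {J} → grid {J} (letter t) ≢ grid #0
letter≢#0 true  ()
letter≢#0 false ()

letter-injective : ∀ {s t} → letter s ≡ letter t → s ≡ t
letter-injective {true}  {true}  _ = refl
letter-injective {false} {false} _ = refl

corner : Bool → Core
corner true  = b′
corner false = a

x-corner : ∀ t → x (corner t) ≡ letter t
x-corner true  = refl
x-corner false = refl

module Rays
  (em : ExcludedMiddle 0ℓ)
  (J : Set) (bits : J → ℕ → Bool)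
  (bits-injective : ∀ {i j} → bits i ≗ bits j → i ≡ j)
  where

  word : J → ℕ → Bool
  word j = marked (bits j)

  -- Ray j runs through ry j 0, rz j 0, rx j 0, ry j 1, rz j 1, …: neighbours share a link
  -- coloured X, Y, Z in turn, and each vertex hangs on one grid line of the third colour,
  -- namely y = 2, z = 2, or x = 1 or 2 as dictated by the word of j. No two of these grid
  -- lines of different colours meet in the core, so the rays create no new triangles.
  data Vertex : Set where
    core     : Core → Vertex
    ry rz rx : J → ℕ → Vertex

  lineX lineY lineZ : Vertex → Line J
  lineX (core p) = grid (x p)
  lineX (ry j k) = link j k
  lineX (rz j k) = link j k
  lineX (rx j k) = grid (letter (word j k))
  lineY (core p) = grid (y p)
  lineY (ry j k) = grid #2
  lineY (rz j k) = link j k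
  lineY (rx j k) = link j k
  lineZ (core p) = grid (z p)
  lineZ (ry j k) = link j k
  lineZ (rz j k) = grid #2
  lineZ (rx j k) = link j (suc k)

  meetXY : ∀ u v → lineX u ≡ lineX v → lineY u ≡ lineY v → u ≡ v
  meetXY (core p) (core q) e e′ = cong core (coords-injective p q (grid-injective e) (grid-injective e′))
  meetXY (ry _ _) (ry _ _) refl _ = refl
  meetXY (rz _ _) (rz _ _) refl _ = refl
  meetXY (rx _ _) (rx _ _) _ refl = refl

  meetYZ : ∀ u v → lineY u ≡ lineY v → lineZ u ≡ lineZ v → u ≡ v
  meetYZ (core p) (core q) e e′ = cong core (yz-injective p q (grid-injective e) (grid-injective e′))
  meetYZ (ry _ _) (ry _ _) _ refl = refl
  meetYZ (rz _ _) (rz _ _) refl _ = refl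
  meetYZ (rx _ _) (rx _ _) refl _ = refl

  meetXZ : ∀ u v → lineX u ≡ lineX v → lineZ u ≡ lineZ v → u ≡ v
  meetXZ (core p) (core q) e e′ = cong core (xz-injective p q (grid-injective e) (grid-injective e′))
  meetXZ (ry _ _) (ry _ _) refl _ = refl
  meetXZ (rz _ _) (rz _ _) refl _ = refl
  meetXZ (rx _ _) (rx _ _) _ refl = refl

  Triangle : Vertex → Vertex → Vertex → Set
  Triangle u v w = lineX v ≡ lineX w × lineY u ≡ lineY w × lineZ u ≡ lineZ v

  data InCore : Vertex → Vertex → Vertex → Set where
    inCore : ∀ p q r → Triangleᶜ p q r → InCore (core p) (core q) (core r)

  triangle : ∀ u v w → Triangle u v w → u ≢ v → InCore u v w
  triangle (core p) (core q) (core r) (ex , ey , ez) _ =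
    inCore p q r (grid-injective ex , grid-injective ey , grid-injective ez)
  triangle (ry i m) (rx j k) (core b) (ex , _ , _) _ = contradiction ex (letter≢#0 (word j k))
  triangle (core a) (rz _ _) (ry _ _) (_ , () , _)
  triangle (core c) (rz _ _) (ry _ _) (_ , () , _)
  triangle (ry _ _) (ry _ _) (ry _ _) (_ , _ , refl) u≢v = contradiction refl u≢v
  triangle (rz _ _) (rz _ _) (rz _ _) (refl , refl , _) u≢v = contradiction refl u≢v
  -- The shift in `lineZ` keeps a ray from closing up: the link of `rx j k` has number `suc k`, that
  -- of `ry j k` has number `k`.
  triangle (rx _ _) (ry _ _) (rz _ _) (refl , refl , ())
  triangle (rz _ _) (core c) (rx j k) (ex , _ , _) _ = contradiction (sym ex) (letter≢#0 (word j k))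
  triangle (rx _ _) (rx _ _) (rx _ _) (_ , _ , refl) u≢v = contradiction refl u≢v

  -- Distinct vertices share at most one label, so nondegeneracy passes from each triangle to the
  -- next. All four then lie in the core, where `no-windingᶜ` applies.
  no-winding : ∀ o g₀ g₁ g₂ g₃ g₄ → g₀ ≢ o → Triangle o g₁ g₀ → Triangle g₁ o g₂ →
    Triangle g₃ g₂ o → ¬ Triangle o g₄ g₃
  no-winding o g₀ g₁ g₂ g₃ g₄ g₀≢o
    t₁@(x₁ , y₁ , z₁) t₂@(x₂ , y₂ , z₂) t₃@(x₃ , y₃ , z₃) t₄@(x₄ , y₄ , z₄) =
    conclude (triangle o g₁ g₀ t₁ (g₁≢o ∘ sym)) (triangle g₁ o g₂ t₂ g₁≢o)
             (triangle g₃ g₂ o t₃ g₃≢g₂) (triangle o g₄ g₃ t₄ (g₄≢o ∘ sym))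
    where
    g₁≢o : g₁ ≢ o
    g₁≢o refl = g₀≢o (meetXY _ _ (sym x₁) (sym y₁))
    g₂≢o : g₂ ≢ o
    g₂≢o refl = g₁≢o (meetYZ _ _ y₂ z₂)
    g₃≢g₂ : g₃ ≢ g₂
    g₃≢g₂ refl = g₂≢o (meetXY _ _ x₃ y₃)
    g₄≢o : g₄ ≢ o
    g₄≢o refl with refl ← meetXY _ _ x₄ y₄ = g₂≢o (meetXZ _ _ x₃ (sym z₃))
    conclude : InCore o g₁ g₀ → InCore g₁ o g₂ → InCore g₃ g₂ o → ¬ InCore o g₄ g₃
    conclude (inCore o g₁ g₀ t₁) (inCore _ _ g₂ t₂) (inCore g₃ _ _ t₃) (inCore _ g₄ _ t₄) =
      no-windingᶜ o g₀ (g₀≢o ∘ cong core) g₁ t₁ g₂ t₂ g₃ t₃ g₄ t₄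

  coreXY : ∀ {s t} v → lineX v ≡ grid s → lineY v ≡ grid t → Σ[ p ∈ Core ] v ≡ core p
  coreXY (core p) _ _ = p , refl

  coreXZ : ∀ {s t} v → lineX v ≡ grid s → lineZ v ≡ grid t → Σ[ p ∈ Core ] v ≡ core p
  coreXZ (core p) _ _ = p , refl

  coreYZ : ∀ {s t} v → lineY v ≡ grid s → lineZ v ≡ grid t → Σ[ p ∈ Core ] v ≡ core p
  coreYZ (core p) _ _ = p , refl

  onY₂ : ∀ v → lineY v ≡ grid #2 → v ≡ core b ⊎ (Σ[ j ∈ J ] Σ[ k ∈ ℕ ] v ≡ ry j k)
  onY₂ (core b) _ = inj₁ refl
  onY₂ (ry j k) _ = inj₂ (j , k , refl)

  Z₁Y₂-disjoint : ∀ v → lineZ v ≡ grid #1 → lineY v ≢ grid #2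
  Z₁Y₂-disjoint (core a′) _ ()
  Z₁Y₂-disjoint (core b′) _ ()

  -- Each corner image lies on two grid lines of different colours through the image of the middle
  -- triangle. This puts it in the core and reduces the claim to the enumeration.
  core-rigid : ∀ {ga′ gb′ gc′ ga gb gc} → InCore ga′ gb′ gc′ → ga′ ≢ gb′ →
    lineY ga ≡ lineY gb′ → lineZ ga ≡ lineZ gc′ →
    lineX gb ≡ lineX ga′ → lineZ gb ≡ lineZ gc′ → lineZ gb ≡ lineZ ga →
    lineX gc ≡ lineX ga′ → lineX gc ≡ lineX gb → lineY gc ≡ lineY gb′ → lineY gc ≡ lineY ga →
    (ga ≡ core a × gb ≡ core b × gc ≡ core c) × (ga′ ≡ core a′ × gb′ ≡ core b′ × gc′ ≡ core c′)
  core-rigid (inCore p q r tr) p≢q e₁ e₂ e₃ e₄ e₅ e₆ e₇ e₈ e₉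
    with s , refl ← coreYZ _ e₁ e₂ | t , refl ← coreXZ _ e₃ e₄ | u , refl ← coreXY _ e₆ e₈
    with ((refl , refl , refl) , (refl , refl , refl)) ← core-rigidᶜ p q r tr (p≢q ∘ cong core)
      s (grid-injective e₁) (grid-injective e₂)
      t (grid-injective e₃) (grid-injective e₄ , grid-injective e₅)
      u (grid-injective e₆ , grid-injective e₇) (grid-injective e₈ , grid-injective e₉)
    = (refl , refl , refl) , (refl , refl , refl)

  -- Maps preserving the three relations

  system : System (Fin 3) Vertex
  system = kernels lineX lineY lineZ

  module Preserving (f : Vertex → Vertex) (pres : PreservesSystem f system) where

    presX : ∀ u v → lineX u ≡ lineX v → lineX (f u) ≡ lineX (f v)
    presX u v = pres zero {u} {v}
    presY : ∀ u v → lineY u ≡ lineY v → lineY (f u) ≡ lineY (f v)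
    presY u v = pres (suc zero) {u} {v}
    presZ : ∀ u v → lineZ u ≡ lineZ v → lineZ (f u) ≡ lineZ (f v)
    presZ u v = pres (suc (suc zero)) {u} {v}

    pres-triangle : ∀ u v w → Triangle u v w → Triangle (f u) (f v) (f w)
    pres-triangle u v w (ex , ey , ez) = presX v w ex , presY u w ey , presZ u v ez

    module Collapsing (a′≡b′ : f (core a′) ≡ f (core b′)) where

      o : Vertex
      o = f (core a′)

      -- First `c′`, then the corners: each shares two labels with midpoints already sent to `o`.
      onto-o : ∀ p → f (core p) ≡ o
      onto-o a  = meetYZ _ _ (trans (presY (core a) (core b′) refl) (cong lineY (sym a′≡b′)))
                             (trans (presZ (core a) (core c′) refl) (cong lineZ (onto-o c′)))
      onto-o b  = meetXZ _ _ (presX (core b) (core a′) refl)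
                             (trans (presZ (core b) (core c′) refl) (cong lineZ (onto-o c′)))
      onto-o c  = meetXY _ _ (presX (core c) (core a′) refl)
                             (trans (presY (core c) (core b′) refl) (cong lineY (sym a′≡b′)))
      onto-o a′ = refl
      onto-o b′ = sym a′≡b′
      onto-o c′ = meetXY _ _ (trans (presX (core c′) (core b′) refl) (cong lineX (sym a′≡b′)))
                             (presY (core c′) (core a′) refl)

      ryY : ∀ j k → lineY (f (ry j k)) ≡ lineY o
      ryY j k = trans (presY (ry j k) (core b) refl) (cong lineY (onto-o b))
      rzZ : ∀ j k → lineZ (f (rz j k)) ≡ lineZ o
      rzZ j k = trans (presZ (rz j k) (core c) refl) (cong lineZ (onto-o c))
      rxX : ∀ j k → lineX (f (rx j k)) ≡ lineX o
      rxX j k = trans (presX (rx j k) (core (corner (word j k))) (cong grid (sym (x-corner (word j k)))))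
                      (cong lineX (onto-o _))

      -- The image of every ray vertex keeps one label of `o`, so each edge of the ray spans a
      -- triangle with `o`. The four edges from `ry j k` onwards wind around `o`.
      ry≡o : ∀ j k → f (ry j k) ≡ o
      ry≡o j k = decidable-stable em λ ry≢o → no-winding o
        (f (ry j k)) (f (rz j k)) (f (rx j k)) (f (ry j (suc k))) (f (rz j (suc k))) ry≢o
        (presX (rz j k) (ry j k) refl , sym (ryY j k) , sym (rzZ j k))
        (sym (rxX j k) , presY (rz j k) (rx j k) refl , rzZ j k)
        (rxX j k , ryY j (suc k) , presZ (ry j (suc k)) (rx j k) refl)
        (presX (rz j (suc k)) (ry j (suc k)) refl , sym (ryY j (suc k)) , sym (rzZ j (suc k)))

      rz≡o : ∀ j k → f (rz j k) ≡ o
      rz≡o j k = meetXZ _ _ (trans (presX (rz j k) (ry j k) refl) (cong lineX (ry≡o j k))) (rzZ j k)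

      constant : ∀ u → f u ≡ o
      constant (core p) = onto-o p
      constant (ry j k) = ry≡o j k
      constant (rz j k) = rz≡o j k
      constant (rx j k) = meetXY _ _ (rxX j k) (trans (presY (rx j k) (rz j k) refl) (cong lineY (rz≡o j k)))

    module Fixing (a′≢b′ : f (core a′) ≢ f (core b′)) where

      fixes-core : ∀ p → f (core p) ≡ core p
      fixes-core with (ea , eb , ec) , (ea′ , eb′ , ec′) ← core-rigid
        (triangle _ _ _ (pres-triangle (core a′) (core b′) (core c′) (refl , refl , refl)) a′≢b′) a′≢b′
        (presY (core a) (core b′) refl) (presZ (core a) (core c′) refl)
        (presX (core b) (core a′) refl) (presZ (core b) (core c′) refl) (presZ (core b) (core a) refl)
        (presX (core c) (core a′) refl) (presX (core c) (core b) refl)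
        (presY (core c) (core b′) refl) (presY (core c) (core a) refl)
        = λ { a → ea ; b → eb ; c → ec ; a′ → ea′ ; b′ → eb′ ; c′ → ec′ }

      ryY : ∀ j k → lineY (f (ry j k)) ≡ grid #2
      ryY j k = trans (presY (ry j k) (core b) refl) (cong lineY (fixes-core b))
      rzZ : ∀ j k → lineZ (f (rz j k)) ≡ grid #2
      rzZ j k = trans (presZ (rz j k) (core c) refl) (cong lineZ (fixes-core c))
      rxX : ∀ j k → lineX (f (rx j k)) ≡ grid (letter (word j k))
      rxX j k = trans (presX (rx j k) (core (corner (word j k))) (cong grid (sym (x-corner (word j k)))))
                      (trans (cong lineX (fixes-core _)) (cong grid (x-corner (word j k))))

      meet-rz : ∀ {i m} v → lineX v ≡ link i m → lineZ v ≡ grid #2 → v ≡ rz i m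
      meet-rz (rz _ _) refl _ = refl

      meet-rx : ∀ {i m t} v → lineY v ≡ link i m → lineX v ≡ grid t →
        v ≡ rx i m × letter (word i m) ≡ t
      meet-rx (rx _ _) refl refl = refl , refl

      meet-ry : ∀ {i m} v → lineZ v ≡ link i m → lineY v ≡ grid #2 → v ≡ ry i m
      meet-ry (ry _ _) refl refl = refl

      module _ (j : J) where

        rz-follows : ∀ {i m} k → f (ry j k) ≡ ry i m → f (rz j k) ≡ rz i m
        rz-follows k e = meet-rz _ (trans (presX (rz j k) (ry j k) refl) (cong lineX e)) (rzZ j k)

        rx-follows : ∀ {i m} k → f (ry j k) ≡ ry i m →
          f (rx j k) ≡ rx i m × letter (word i m) ≡ letter (word j k)
        rx-follows k e = meet-rx _ (trans (presY (rx j k) (rz j k) refl) (cong lineY (rz-follows k e))) (rxX j k)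

        ry-follows : ∀ {i m} k → f (ry j k) ≡ ry i m → f (ry j (suc k)) ≡ ry i (suc m)
        ry-follows k e = meet-ry _ (trans (presZ (ry j (suc k)) (rx j k) refl) (cong lineZ (proj₁ (rx-follows k e))))
                                (ryY j (suc k))

        start : Σ[ i ∈ J ] Σ[ m ∈ ℕ ] f (ry j 0) ≡ ry i m
        start with onY₂ _ (ryY j 0)
        ... | inj₂ found = found
        -- As the word starts with 1, `rx j 0` would go to the point `b′` with `x = 1` and `y = 0`.
        -- Then `ry j 1` would need `z = 1` and `y = 2`, where there is no vertex.
        ... | inj₁ at-b = contradiction (ryY j 1) (Z₁Y₂-disjoint _
                (trans (presZ (ry j 1) (rx j 0) refl) (cong lineZ at-b′)))
          where
          at-c : f (rz j 0) ≡ core c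
          at-c = meetXZ _ _ (trans (presX (rz j 0) (ry j 0) refl) (cong lineX at-b)) (rzZ j 0)
          at-b′ : f (rx j 0) ≡ core b′
          at-b′ = meetXY _ _ (rxX j 0) (trans (presY (rx j 0) (rz j 0) refl) (cong lineY at-c))

        shift : ∀ {i m} → f (ry j 0) ≡ ry i m → ∀ k → f (ry j k) ≡ ry i (m + k)
        shift e zero    = trans e (cong (ry _) (sym (+-identityʳ _)))
        shift e (suc k) = trans (ry-follows k (shift e k)) (cong (ry _) (sym (+-suc _ k)))

        fixes-ry : ∀ k → f (ry j k) ≡ ry j k
        fixes-ry k with i , m , e ← start
          with refl , c≗b ← marked-tail (bits j) (bits i) m
                 (λ k → letter-injective (proj₂ (rx-follows k (shift e k))))
          with refl ← bits-injective c≗b = shift e k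

      identity : f ≗ id
      identity (core p) = fixes-core p
      identity (ry j k) = fixes-ry j k
      identity (rz j k) = rz-follows j k (fixes-ry j k)
      identity (rx j k) = proj₁ (rx-follows j k (fixes-ry j k))

  semirigid : Semirigid system
  semirigid f pres with em {f (core a′) ≡ f (core b′)}
  ... | yes eq = inj₂ (_ , Preserving.Collapsing.constant f pres eq)
  ... | no neq = inj₁ (Preserving.Fixing.identity f pres neq)

-- Matching the vertices with a given infinite set

rank : Core → ℕ
rank a  = 0
rank b  = 1
rank c  = 2
rank a′ = 3
rank b′ = 4
rank c′ = 5

rank-injective : ∀ p q → rank p ≡ rank q → p ≡ q
rank-injective a  a  _ = refl
rank-injective b  b  _ = refl
rank-injective c  c  _ = refl
rank-injective a′ a′ _ = refl
rank-injective b′ b′ _ = refl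
rank-injective c′ c′ _ = refl

-- This is `r + 4 * k`: each sequence `point j` is split into four, for the core and the three kinds
-- of ray vertices.
code : Fin 4 → ℕ → ℕ
code r zero    = toℕ r
code r (suc k) = 4 + code r k

code-injective : ∀ r s k l → code r k ≡ code s l → r ≡ s × k ≡ l
code-injective r s zero    zero    eq = toℕ-injective eq , refl
code-injective r s zero    (suc l) eq = contradiction (subst (_< 4) eq (toℕ<n r)) (m+n≮m 4 (code s l))
code-injective r s (suc k) zero    eq = contradiction (subst (_< 4) (sym eq) (toℕ<n s)) (m+n≮m 4 (code r k))
code-injective r s (suc k) (suc l) eq
  with refl , refl ← code-injective r s k l (+-cancelˡ-≡ 4 _ _ eq) = refl , refl

module Infinite
  (em : ExcludedMiddle 0ℓ) (ext : Extensionality 0ℓ 0ℓ) (K : Set) (K↣2^ℕ : K ↣ (ℕ → Bool))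
  (s : ℕ → K) (s-injective : Injective _≡_ _≡_ s)
  where

  open Tower em ext K

  j₀ : J
  j₀ = first s s-injective

  -- The bound by the continuum enters here: sequences of different indices are disjoint, so their
  -- first terms have different binary words.
  bits : J → ℕ → Bool
  bits j = Injection.to K↣2^ℕ (point j 0)

  open Rays em J bits (λ eq → proj₁ (point-injective (Injection.injective K↣2^ℕ (ext eq)))) public

  address : Vertex → J × Fin 4 × ℕ
  address (core p) = j₀ , zero , rank p
  address (ry j k) = j , suc zero , k
  address (rz j k) = j , suc (suc zero) , k
  address (rx j k) = j , suc (suc (suc zero)) , k

  address-injective : ∀ u v → address u ≡ address v → u ≡ v
  address-injective (core p) (core q) eq = cong core (rank-injective p q (cong (proj₂ ∘ proj₂) eq))
  address-injective (ry _ _) (ry _ _) refl = refl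
  address-injective (rz _ _) (rz _ _) refl = refl
  address-injective (rx _ _) (rx _ _) refl = refl

  into-K : Vertex → K
  into-K u = let j , r , k = address u in point j (code r k)

  into-K-injective : Injective _≡_ _≡_ into-K
  into-K-injective {u} {v} eq =
    let i≡j , eq′ = point-injective eq
        r≡s , k≡l = code-injective _ _ _ _ eq′
    in address-injective u v (cong₂ _,_ i≡j (cong₂ _,_ r≡s k≡l))

  -- Tower and remainder use different kinds of vertices to avoid collisions. A location determines
  -- its point, so any choice of locations gives an injection.
  place : ∀ {k} → Located k → Vertex
  place (inj₁ (j , n , _)) = ry j n
  place (inj₂ (i , _))     = rz j₀ (toℕ i)

  rz-index : ∀ {i j m n} → rz i m ≡ rz j n → m ≡ n
  rz-index refl = refl

  place-injective : ∀ {k k′} (d : Located k) (d′ : Located k′) → place d ≡ place d′ → k ≡ k′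
  place-injective (inj₁ (_ , _ , e)) (inj₁ (_ , _ , e′)) refl = trans (sym e) e′
  place-injective (inj₂ (_ , e)) (inj₂ (_ , e′)) eq with eq′ ← rz-index eq
    with refl ← toℕ-injective eq′ = trans (sym e) e′

  Vertex⤖K : Vertex ⤖ K
  Vertex⤖K = CantorBernstein.bijection em into-K into-K-injective
    (λ k → place (locate k)) (place-injective (locate _) (locate _))

theorem9p4 : ExcludedMiddle 0ℓ → Extensionality 0ℓ 0ℓ →
    (K : Set) → ¬ (K ⤖ Fin 2) → ¬ (K ⤖ Fin 4) → K ↣ (ℕ → Bool) →
    Σ[ E ∈ Set ] (E ⤖ K) × (Σ[ ρ ∈ System (Fin 3) E ] Semirigid ρ)
theorem9p4 em ext K K≄2 K≄4 K↣2^ℕ with Sequences.sequence⊎listed em {K} (λ _ → ⊤)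
... | inj₁ (s , s-injective , _) = I.Vertex , I.Vertex⤖K , I.system , I.semirigid
  where module I = Infinite em ext K K↣2^ℕ s s-injective
... | inj₂ (l , all∈) with n , Fin-n⤖K ← listed⇒finite (λ _ _ → em) l (λ k → all∈ k tt) =
  Fin n , Fin-n⤖K , finite n (λ { refl → K≄2 (⤖-sym Fin-n⤖K) }) (λ { refl → K≄4 (⤖-sym Fin-n⤖K) })
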